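{- Let $p$ and $q$ be distinct primes, $n=pq$, and let $e$ be a positive integer with $\gcd(e,\varphi(n))=1$ (so that there is an integer $d$ with $ed\equiv 1 \pmod{\varphi(n)}$). For a positive integer $k$, let $$T_{n,e,k}=\{x\in \mathbb{Z}_n^{\ast} : x^{e^{k}}\equiv x \pmod n \text{ and } x^{e^{m}}\not\equiv x \pmod n \text{ for every positive integer } m<k\}.$$ Then $$|T_{n,e,k}|=\sum_{d\mid k}\mu(k/d)\,\gcd(e^{d}-1,p-1)\,\gcd(e^{d}-1,q-1),$$ where the sum runs over the positive divisors $d$ of $k$ and $\mu$ is the Möbius function.
   Context: $\mathbb{Z}_n^{\ast}$ denotes a reduced residue system modulo $n$ (the residues coprime to $n$), $\varphi$ is Euler's totient function, and $\gcd(a,b)$ is the greatest common divisor (with $\gcd(0,b)=b$). -}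

module Defs where

open import Data.Bool.Base using (if_then_else_)
open import Data.Integer.Base as ℤ using (ℤ; 0ℤ; -1ℤ)
open import Data.List.Base using (List; map; filter; foldr; length; upTo)
open import Data.List.Relation.Unary.Any using (any?)
open import Data.Nat.Base using (ℕ; suc; NonZero; _*_; _^_; _<_; ∣_-_∣)
open import Data.Nat.Coprimality using (coprime?)
open import Data.Nat.Divisibility using (_∣_; _∣?_)
open import Data.Nat.Primality using (prime?)
open import Data.Nat.Properties using (_<?_; allUpTo?)
open import Data.Product.Base using (_×_)
open import Relation.Nullary.Decidable using (Dec; does; ¬?; _×-dec_; _→-dec_)
open import Relation.Nullary.Negation using (¬_)
open import Relation.Unary using (Decidable)

infix 4 _≡_[mod_] _≡?_[mod_]

_≡_[mod_] : ℕ → ℕ → ℕ → Set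
a ≡ b [mod n ] = n ∣ ∣ a - b ∣

_≡?_[mod_] : ∀ a b n → Dec (a ≡ b [mod n ])
a ≡? b [mod n ] = n ∣? ∣ a - b ∣

-- The least non-negative reduced residue system modulo n.
ℤ* : ℕ → List ℕ
ℤ* n = filter (λ x → coprime? x n) (upTo n)

φ : ℕ → ℕ
φ n = length (ℤ* n)

IsT : (n e k : ℕ) → ℕ → Set
IsT n e k x =
  (x ^ (e ^ k) ≡ x [mod n ]) ×
  (∀ {m} → m < k → 0 < m → ¬ (x ^ (e ^ m) ≡ x [mod n ]))

isT? : ∀ n e k → Decidable (IsT n e k)
isT? n e k x =
  (x ^ (e ^ k) ≡? x [mod n ]) ×-dec
  allUpTo? (λ m → (0 <? m) →-dec ¬? (x ^ (e ^ m) ≡? x [mod n ])) k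

-- ℤ* n has no repeated entries, so the length of this list is its cardinality.
T : (n e k : ℕ) → List ℕ
T n e k = filter (isT? n e k) (ℤ* n)

primeDivisors : ℕ → List ℕ
primeDivisors n = filter (λ p → prime? p ×-dec (p ∣? n)) (upTo (suc n))

-- The Möbius function: 0 if some prime square divides n, and otherwise (-1)
-- to the number of distinct primes dividing n.  Only values at n ≥ 1 matter.
μ : ℕ → ℤ
μ n = if does (any? (λ p → p * p ∣? n) (primeDivisors n))
      then 0ℤ
      else -1ℤ ℤ.^ length (primeDivisors n)

-- Sum over the positive divisors d = suc i of k (for k ≥ 1).  The summand takes
-- NonZero d as an instance so that k / d can be written in it.
divisorSum : ∀ k → ((d : ℕ) → .{{NonZero d}} → ℤ) → ℤ
divisorSum k f =
  foldr ℤ._+_ 0ℤ (map (λ i → f (suc i)) (filter (λ i → suc i ∣? k) (upTo k)))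

syntax divisorSum k (λ d → t) = ∑[ d ∣ k ] t

{-# OPTIONS --safe #-}

-- Call d a period of x if x ^ (e ^ d) ≡ x mod n. The periods of x are the multiples of the least
-- positive one, t, so by ∑_{c ∣ m} μ c = [ m = 1 ], applied to m = k / t, the sum of μ (k / d) over
-- the periods d ∣ k is [ t = k ]. Summing over x in ℤ* n expresses |T| through the number of x
-- with period d, i.e. with x ^ (e ^ d ∸ 1) ≡ 1 mod p * q. By the Chinese remainder theorem this
-- number is a product of two counts modulo primes, each of which is a gcd: modulo p the solutions
-- of x ^ m ≡ 1 are those of x ^ gcd m (p ∸ 1) ≡ 1, and for g ∣ p ∸ 1 the polynomial x ^ g - 1
-- divides x ^ (p ∸ 1) - 1, which splits, so it has exactly g roots.
module Submission where

open import Defs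
open import Data.Bool.Base using (true; false; if_then_else_)
open import Data.Integer.Base as ℤ using (ℤ; +_; 0ℤ; 1ℤ; -1ℤ)
import Data.Integer.Divisibility.Signed as ℤ
import Data.Integer.Properties as ℤ
import Data.Integer.Tactic.RingSolver as ℤ-Solver
open import Data.List.Base using (List; []; _∷_; length; map; filter; foldr; upTo; cartesianProduct)
open import Data.List.Membership.Propositional using (_∈_; find; lose)
open import Data.List.Membership.Propositional.Properties
open import Data.List.Membership.Propositional.Properties.WithK using (unique∧set⇒bag)
open import Data.List.Properties using (length-map; length-upTo; length-++)
open import Data.List.Relation.Binary.BagAndSetEquality using (∼bag⇒↭)
open import Data.List.Relation.Binary.Permutation.Propositional using (_↭_; ↭⇒↭ₛ)
import Data.List.Relation.Binary.Permutation.Propositional.Properties as Permutation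
import Data.List.Relation.Binary.Permutation.Setoid.Properties as Permutationₛ
open import Data.List.Relation.Unary.All as All using (All; []; _∷_)
import Data.List.Relation.Unary.All.Properties as All
open import Data.List.Relation.Unary.AllPairs using (AllPairs; []; _∷_)
open import Data.List.Relation.Unary.Any using (Any; here; there; any?)
open import Data.List.Relation.Unary.Unique.Propositional using (Unique)
import Data.List.Relation.Unary.Unique.Propositional.Properties as Unique
open import Data.Nat.Base
open import Data.Nat.Coprimality as Coprime using (Coprime; coprime?; coprime-divisor; coprime-Bézout)
open import Data.Nat.DivMod
open import Data.Nat.Divisibility
open import Data.Nat.GCD using (gcd; gcd[m,n]∣m; gcd[m,n]∣n; gcd-GCD; module Bézout)
open import Data.Nat.Induction using (<-rec)
open import Data.Nat.ListAction using (product)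
open import Data.Nat.ListAction.Properties using (product-↭)
open import Data.Nat.Primality
open import Data.Nat.Primality.Factorisation using (factorise)
import Data.Nat.Properties as ℕ
import Data.Nat.Tactic.RingSolver as ℕ-Solver
open import Data.Product.Base using (∃; _×_; _,_; proj₁; proj₂)
open import Data.Sum.Base as Sum using (_⊎_; inj₁; inj₂; [_,_]′)
open import Data.Vec.Base using (Vec; []; _∷_; replicate; _++_)
open import Function.Base using (_∘_; id; case_of_)
open import Function.Bundles using (_⇔_; mk⇔)
open import Level using (Level)
open import Relation.Binary.PropositionalEquality
open import Relation.Nullary using (Dec; yes; no; does; ¬_; ¬?; contradiction)
open import Relation.Nullary.Decidable using (dec-true; dec-false; does-⇔; _×-dec_)
open import Relation.Unary using (Pred; Decidable)

private
  variable
    a b ℓ₁ ℓ₂ : Level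
    A : Set a
    B : Set b
    P : Pred A ℓ₁
    Q : Pred A ℓ₂
    xs : List A

-- Lists and sums over lists

unique-map : {f : A → B} → (∀ {x y} → x ∈ xs → y ∈ xs → f x ≡ f y → x ≡ y) →
             Unique xs → Unique (map f xs)
unique-map inj []        = []
unique-map inj (x∉ ∷ xs!) =
  All.map⁺ (All.tabulate λ y∈ eq → All.lookup x∉ y∈ (inj (here refl) (there y∈) eq))
  ∷ unique-map (λ x∈ y∈ → inj (there x∈) (there y∈)) xs!

unique-↭ : {xs ys : List A} → Unique xs → Unique ys →
           (∀ {x} → x ∈ xs → x ∈ ys) → (∀ {x} → x ∈ ys → x ∈ xs) → xs ↭ ys
unique-↭ xs! ys! to from = ∼bag⇒↭ (unique∧set⇒bag xs! ys! (mk⇔ to from))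

-- Every bijection below is packaged in this form, from which equality of lengths, sums or products
-- follows. Injectivity is asked for on members only, because maps such as `k / suc i` or reduction
-- modulo `n` are not injective on all of `ℕ`.
map-↭ : {f : A → B} {xs : List A} {ys : List B} → Unique xs → Unique ys →
        (∀ {x y} → x ∈ xs → y ∈ xs → f x ≡ f y → x ≡ y) →
        (∀ {x} → x ∈ xs → f x ∈ ys) →
        (∀ {y} → y ∈ ys → ∃ λ x → x ∈ xs × y ≡ f x) → map f xs ↭ ys
map-↭ {f = f} xs! ys! inj into onto =
  unique-↭ (unique-map inj xs!) ys!
    (λ y∈ → let x , x∈ , y≡ = ∈-map⁻ f y∈ in subst (_∈ _) (sym y≡) (into x∈))
    (λ y∈ → let x , x∈ , y≡ = onto y∈ in subst (_∈ _) (sym y≡) (∈-map⁺ f x∈))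

-- Restricting the two implications to members of the list lets them use coprimality to the modulus
-- when the list is `ℤ* n`.
filter-cong-∈ : (P? : Decidable P) (Q? : Decidable Q) (xs : List A) →
                (∀ {x} → x ∈ xs → P x → Q x) → (∀ {x} → x ∈ xs → Q x → P x) →
                filter P? xs ≡ filter Q? xs
filter-cong-∈ P? Q? []       to from = refl
filter-cong-∈ P? Q? (x ∷ xs) to from
  with ih ← filter-cong-∈ P? Q? xs (to ∘ there) (from ∘ there) | P? x | Q? x
... | yes _  | yes _  = cong (x ∷_) ih
... | no _   | no _   = ih
... | yes px | no ¬qx = contradiction (to (here refl) px) ¬qx
... | no ¬px | yes qx = contradiction (from (here refl) qx) ¬px

length-filter-¬ : (P? : Decidable P) (xs : List A) →
                  length (filter P? xs) + length (filter (¬? ∘ P?) xs) ≡ length xs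
length-filter-¬ P? []       = refl
length-filter-¬ P? (x ∷ xs) with P? x
... | yes _ = cong suc (length-filter-¬ P? xs)
... | no _  = trans (ℕ.+-suc _ _) (cong suc (length-filter-¬ P? xs))

length-cartesianProduct : (xs : List A) (ys : List B) →
                          length (cartesianProduct xs ys) ≡ length xs * length ys
length-cartesianProduct []       ys = refl
length-cartesianProduct (x ∷ xs) ys = trans (length-++ (map (x ,_) ys))
  (cong₂ _+_ (length-map (x ,_) ys) (length-cartesianProduct xs ys))

-- The Iverson bracket: it turns a count into a sum, so that summations can be exchanged.
⟦_⟧ : Dec A → ℤ
⟦ A? ⟧ = if does A? then 1ℤ else 0ℤ

⟦⟧-yes : (A? : Dec A) → A → ⟦ A? ⟧ ≡ 1ℤ
⟦⟧-yes A? x = cong (if_then 1ℤ else 0ℤ) (dec-true A? x)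

⟦⟧-no : (A? : Dec A) → ¬ A → ⟦ A? ⟧ ≡ 0ℤ
⟦⟧-no A? ¬x = cong (if_then 1ℤ else 0ℤ) (dec-false A? ¬x)

sumOver : List A → (A → ℤ) → ℤ
sumOver xs f = foldr ℤ._+_ 0ℤ (map f xs)

sumOver-cong : (xs : List A) {f g : A → ℤ} → (∀ {x} → x ∈ xs → f x ≡ g x) →
               sumOver xs f ≡ sumOver xs g
sumOver-cong []       f≗g = refl
sumOver-cong (x ∷ xs) f≗g = cong₂ ℤ._+_ (f≗g (here refl)) (sumOver-cong xs (f≗g ∘ there))

sumOver-zero : (xs : List A) {f : A → ℤ} → (∀ {x} → x ∈ xs → f x ≡ 0ℤ) → sumOver xs f ≡ 0ℤ
sumOver-zero []       f≗0 = refl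
sumOver-zero (x ∷ xs) f≗0 = cong₂ ℤ._+_ (f≗0 (here refl)) (sumOver-zero xs (f≗0 ∘ there))

sumOver-+ : (xs : List A) (f g : A → ℤ) →
            sumOver xs (λ x → f x ℤ.+ g x) ≡ sumOver xs f ℤ.+ sumOver xs g
sumOver-+ []       f g = refl
sumOver-+ (x ∷ xs) f g =
  trans (cong (ℤ._+_ (f x ℤ.+ g x)) (sumOver-+ xs f g)) (interchange (f x) (g x) _ _)
  where
  interchange : ∀ s t u v → s ℤ.+ t ℤ.+ (u ℤ.+ v) ≡ (s ℤ.+ u) ℤ.+ (t ℤ.+ v)
  interchange = ℤ-Solver.solve-∀

sumOver-*ˡ : (xs : List A) (c : ℤ) (f : A → ℤ) →
             c ℤ.* sumOver xs f ≡ sumOver xs (λ x → c ℤ.* f x)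
sumOver-*ˡ []       c f = ℤ.*-zeroʳ c
sumOver-*ˡ (x ∷ xs) c f =
  trans (ℤ.*-distribˡ-+ c (f x) _) (cong (ℤ._+_ (c ℤ.* f x)) (sumOver-*ˡ xs c f))

sumOver-swap : (xs : List A) (ys : List B) (f : A → B → ℤ) →
               sumOver xs (λ x → sumOver ys (f x)) ≡ sumOver ys (λ y → sumOver xs (λ x → f x y))
sumOver-swap []       ys f = sym (sumOver-zero ys λ _ → refl)
sumOver-swap (x ∷ xs) ys f =
  trans (cong (ℤ._+_ (sumOver ys (f x))) (sumOver-swap xs ys f)) (sym (sumOver-+ ys (f x) _))

sumOver-filter : (P? : Decidable P) (xs : List A) (f : A → ℤ) →
                 sumOver (filter P? xs) f ≡ sumOver xs (λ x → f x ℤ.* ⟦ P? x ⟧)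
sumOver-filter P? []       f = refl
sumOver-filter P? (x ∷ xs) f with P? x
... | yes _ = cong₂ ℤ._+_ (sym (ℤ.*-identityʳ (f x))) (sumOver-filter P? xs f)
... | no _  = trans (sumOver-filter P? xs f)
  (sym (trans (cong (ℤ._+ _) (ℤ.*-zeroʳ (f x))) (ℤ.+-identityˡ _)))

sumOver-filter-¬ : (P? : Decidable P) (xs : List A) (f : A → ℤ) →
                   sumOver xs f ≡ sumOver (filter P? xs) f ℤ.+ sumOver (filter (¬? ∘ P?) xs) f
sumOver-filter-¬ P? []       f = refl
sumOver-filter-¬ P? (x ∷ xs) f with P? x
... | yes _ = trans (cong (ℤ._+_ (f x)) (sumOver-filter-¬ P? xs f)) (sym (ℤ.+-assoc (f x) _ _))
... | no _  = trans (cong (ℤ._+_ (f x)) (sumOver-filter-¬ P? xs f))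
                    (exchange (f x) (sumOver (filter P? xs) f) _)
  where
  exchange : ∀ s t u → s ℤ.+ (t ℤ.+ u) ≡ t ℤ.+ (s ℤ.+ u)
  exchange = ℤ-Solver.solve-∀

sumOver-map : (g : A → B) (xs : List A) (f : B → ℤ) → sumOver (map g xs) f ≡ sumOver xs (f ∘ g)
sumOver-map g []       f = refl
sumOver-map g (x ∷ xs) f = cong (ℤ._+_ (f (g x))) (sumOver-map g xs f)

sumOver-↭ : {xs ys : List A} (f : A → ℤ) → xs ↭ ys → sumOver xs f ≡ sumOver ys f
sumOver-↭ f xs↭ys =
  Permutationₛ.foldr-commMonoid (setoid ℤ) ℤ.+-0-isCommutativeMonoid
    (↭⇒↭ₛ (Permutation.map⁺ f xs↭ys))

length-filter-⟦⟧ : (P? : Decidable P) (xs : List A) →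
                   + length (filter P? xs) ≡ sumOver xs (λ x → ⟦ P? x ⟧)
length-filter-⟦⟧ P? []       = refl
length-filter-⟦⟧ P? (x ∷ xs) with P? x
... | yes _ = cong (ℤ._+_ 1ℤ) (length-filter-⟦⟧ P? xs)
... | no _  = trans (length-filter-⟦⟧ P? xs) (sym (ℤ.+-identityˡ _))

-- The Möbius function

coprime⇒*-∣ : ∀ {m n k} → Coprime m n → m ∣ k → n ∣ k → m * n ∣ k
coprime⇒*-∣ {m} {n} m⊥n (divides-refl c) n∣cm =
  subst (_∣ c * m) (ℕ.*-comm n m)
    (*-monoˡ-∣ m (coprime-divisor (Coprime.sym m⊥n) (subst (n ∣_) (ℕ.*-comm c m) n∣cm)))

prime∤⇒coprime : ∀ {p n} → Prime p → p ∤ n → Coprime p n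
prime∤⇒coprime p-prime p∤n (i∣p , i∣n) with prime⇒irreducible p-prime i∣p
... | inj₁ i≡1  = i≡1
... | inj₂ refl = contradiction i∣n p∤n

distinct-primes⇒coprime : ∀ {p q} → Prime p → Prime q → p ≢ q → Coprime p q
distinct-primes⇒coprime p-prime q-prime p≢q =
  prime∤⇒coprime p-prime λ p∣q → case prime⇒irreducible q-prime p∣q of λ where
    (inj₁ refl) → contradiction p-prime ¬prime[1]
    (inj₂ p≡q)  → p≢q p≡q

primeDivisor : ∀ n .{{_ : NonZero n}} → n ≢ 1 → ∃ λ r → Prime r × r ∣ n
primeDivisor n n≢1 with factorise n
... | record { factors = []; isFactorisation = n≡1 } = contradiction n≡1 n≢1
... | record { factors = r ∷ rs; isFactorisation = refl; factorsPrime = r-prime ∷ _ } =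
  r , r-prime , m∣m*n _

∣⇒nonZero : ∀ {d n} .{{_ : NonZero n}} → d ∣ n → NonZero d
∣⇒nonZero {zero}  {n} 0∣n = contradiction (0∣⇒≡0 0∣n) (≢-nonZero⁻¹ n)
∣⇒nonZero {suc _}     _   = _

divisors : ℕ → List ℕ
divisors n = filter (_∣? n) (upTo (suc n))

∈-divisors⁺ : ∀ {n d} .{{_ : NonZero n}} → d ∣ n → d ∈ divisors n
∈-divisors⁺ d∣n = ∈-filter⁺ (_∣? _) (∈-upTo⁺ (s≤s (∣⇒≤ d∣n))) d∣n

∈-divisors⁻ : ∀ {n d} → d ∈ divisors n → d ∣ n
∈-divisors⁻ {n} = proj₂ ∘ ∈-filter⁻ (_∣? n) {xs = upTo (suc n)}

divisors-unique : ∀ n → Unique (divisors n)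
divisors-unique n = Unique.filter⁺ (_∣? n) (Unique.upTo⁺ (suc n))

primeDivisor? : ∀ n → Decidable (λ r → Prime r × r ∣ n)
primeDivisor? n r = prime? r ×-dec (r ∣? n)

∈-primeDivisors⁺ : ∀ {n r} .{{_ : NonZero n}} → Prime r → r ∣ n → r ∈ primeDivisors n
∈-primeDivisors⁺ {n} r-prime r∣n = ∈-filter⁺ (primeDivisor? n) (∈-upTo⁺ (s≤s (∣⇒≤ r∣n))) (r-prime , r∣n)

∈-primeDivisors⁻ : ∀ {n r} → r ∈ primeDivisors n → Prime r × r ∣ n
∈-primeDivisors⁻ {n} = proj₂ ∘ ∈-filter⁻ (primeDivisor? n) {xs = upTo (suc n)}

primeDivisors-unique : ∀ n → Unique (primeDivisors n)
primeDivisors-unique n = Unique.filter⁺ (primeDivisor? n) (Unique.upTo⁺ (suc n))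

μ-square : ∀ {n r} .{{_ : NonZero n}} → Prime r → r * r ∣ n → μ n ≡ 0ℤ
μ-square {n} {r} r-prime r²∣n =
  cong (if_then 0ℤ else -1ℤ ℤ.^ length (primeDivisors n))
    (dec-true (any? (λ p → p * p ∣? n) (primeDivisors n))
      (lose (∈-primeDivisors⁺ r-prime (∣-trans (m∣m*n r) r²∣n)) r²∣n))

module _ {r d : ℕ} (r-prime : Prime r) (r∤d : r ∤ d) .{{_ : NonZero d}} where

  private
    instance
      r≢0 : NonZero r
      r≢0 = prime⇒nonZero r-prime

      rd≢0 : NonZero (r * d)
      rd≢0 = ℕ.m*n≢0 r d

  -- Since `r ∤ d`, the list `r ∷ primeDivisors d` is free of repetitions, and by Euclid's lemma it
  -- has the members of `primeDivisors (r * d)`, possibly in another order.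
  length-primeDivisors-* : length (primeDivisors (r * d)) ≡ suc (length (primeDivisors d))
  length-primeDivisors-* = Permutation.↭-length
    (unique-↭ (primeDivisors-unique (r * d))
      (All.tabulate (λ { s∈ refl → r∤d (proj₂ (∈-primeDivisors⁻ {d} s∈)) }) ∷ primeDivisors-unique d)
      to from)
    where
    to : ∀ {s} → s ∈ primeDivisors (r * d) → s ∈ r ∷ primeDivisors d
    to s∈ with s-prime , s∣rd ← ∈-primeDivisors⁻ {r * d} s∈ | euclidsLemma r d s-prime s∣rd
    ... | inj₂ s∣d = there (∈-primeDivisors⁺ s-prime s∣d)
    ... | inj₁ s∣r with prime⇒irreducible r-prime s∣r
    ...   | inj₁ refl = contradiction s-prime ¬prime[1]
    ...   | inj₂ refl = here refl

    from : ∀ {s} → s ∈ r ∷ primeDivisors d → s ∈ primeDivisors (r * d)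
    from (here refl) = ∈-primeDivisors⁺ r-prime (m∣m*n d)
    from (there s∈)  with s-prime , s∣d ← ∈-primeDivisors⁻ {d} s∈ =
      ∈-primeDivisors⁺ s-prime (∣n⇒∣m*n r s∣d)

  squareDivisor-prime-* :
    (∃ λ s → Prime s × s * s ∣ r * d) → ∃ λ s → Prime s × s * s ∣ d
  squareDivisor-prime-* (s , s-prime , s²∣rd) =
    s , s-prime , coprime-divisor (Coprime.sym (prime∤⇒coprime r-prime r∤s²)) s²∣rd
    where
    r∤s : r ∤ s
    r∤s r∣s with prime⇒irreducible s-prime r∣s
    ... | inj₁ refl = contradiction r-prime ¬prime[1]
    -- Here `s` is `r`, and `r * r ∣ r * d` would give `r ∣ d`.
    ... | inj₂ refl = r∤d (*-cancelˡ-∣ r s²∣rd)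

    r∤s² : r ∤ s * s
    r∤s² r∣s² with euclidsLemma s s r-prime r∣s²
    ... | inj₁ r∣s = r∤s r∣s
    ... | inj₂ r∣s = r∤s r∣s

  squareful-prime-*-⇔ : Any (λ s → s * s ∣ r * d) (primeDivisors (r * d)) ⇔
                        Any (λ s → s * s ∣ d) (primeDivisors d)
  squareful-prime-*-⇔ = mk⇔ to from
    where
    to : _ → _
    to sq with s , s∈ , s²∣rd ← find sq
       with s , s-prime , s²∣d ← squareDivisor-prime-* (s , proj₁ (∈-primeDivisors⁻ {r * d} s∈) , s²∣rd) =
      lose (∈-primeDivisors⁺ s-prime (∣-trans (m∣m*n s) s²∣d)) s²∣d

    from : _ → _
    from sq with s , s∈ , s²∣d ← find sq
            with s-prime , s∣d ← ∈-primeDivisors⁻ {d} s∈ =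
      lose (∈-primeDivisors⁺ s-prime (∣n⇒∣m*n r s∣d)) (∣n⇒∣m*n r s²∣d)

  -- Both ingredients of `μ` are compared: a prime square divides `r * d` exactly when one divides
  -- `d`, and `r` contributes one further prime, hence one further factor `-1ℤ`.
  μ-prime-* : μ (r * d) ≡ ℤ.- μ d
  μ-prime-* rewrite length-primeDivisors-*
    | does-⇔ squareful-prime-*-⇔ (any? (λ s → s * s ∣? r * d) (primeDivisors (r * d)))
                                 (any? (λ s → s * s ∣? d) (primeDivisors d))
    with does (any? (λ s → s * s ∣? d) (primeDivisors d))
  ... | true  = refl
  ... | false = ℤ.-1*i≡-i _

-- For a prime r ∣ n, multiplication by r pairs the divisors d prime to r with those divisible by r
-- exactly once, and μ (r * d) ≡ - μ d; the divisors left over are multiples of r * r.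
sumOver-μ-divisors : ∀ n .{{_ : NonZero n}} → n ≢ 1 → sumOver (divisors n) μ ≡ 0ℤ
sumOver-μ-divisors n n≢1 with r , r-prime , r∣n ← primeDivisor n n≢1 = begin
  sumOver (divisors n) μ                                ≡⟨ sumOver-filter-¬ (r ∣?_) (divisors n) μ ⟩
  sumOver multiples μ ℤ.+ sumOver nonmultiples μ        ≡⟨ cong (ℤ._+ sumOver nonmultiples μ) multiples-sum ⟩
  ℤ.- sumOver nonmultiples μ ℤ.+ sumOver nonmultiples μ ≡⟨ ℤ.+-inverseˡ (sumOver nonmultiples μ) ⟩
  0ℤ                                                    ∎
  where
  open ≡-Reasoning

  instance
    r≢0 : NonZero r
    r≢0 = prime⇒nonZero r-prime

  multiples nonmultiples simpleMultiples : List ℕ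
  multiples       = filter (r ∣?_) (divisors n)
  nonmultiples    = filter (¬? ∘ (r ∣?_)) (divisors n)
  simpleMultiples = filter (¬? ∘ (r * r ∣?_)) multiples

  ∈-nonmultiples⁻ : ∀ {d} → d ∈ nonmultiples → d ∣ n × r ∤ d
  ∈-nonmultiples⁻ d∈ with d∈ds , r∤d ← ∈-filter⁻ (¬? ∘ (r ∣?_)) {xs = divisors n} d∈ =
    ∈-divisors⁻ d∈ds , r∤d

  times-r-↭ : map (r *_) nonmultiples ↭ simpleMultiples
  times-r-↭ = map-↭
    (Unique.filter⁺ _ (divisors-unique n))
    (Unique.filter⁺ _ (Unique.filter⁺ _ (divisors-unique n)))
    (λ {x} {y} _ _ → ℕ.*-cancelˡ-≡ x y r)
    into onto
    where
    into : ∀ {d} → d ∈ nonmultiples → r * d ∈ simpleMultiples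
    into {d} d∈ with d∣n , r∤d ← ∈-nonmultiples⁻ d∈ =
      ∈-filter⁺ _ (∈-filter⁺ _ (∈-divisors⁺ rd∣n) (m∣m*n d)) (r∤d ∘ *-cancelˡ-∣ r)
      where
      rd∣n : r * d ∣ n
      rd∣n = coprime⇒*-∣ (prime∤⇒coprime r-prime r∤d) r∣n d∣n

    onto : ∀ {d} → d ∈ simpleMultiples → ∃ λ x → x ∈ nonmultiples × d ≡ r * x
    onto d∈ with d∈′ , r²∤d ← ∈-filter⁻ (¬? ∘ (r * r ∣?_)) {xs = multiples} d∈
            with d∈ds , divides-refl x ← ∈-filter⁻ (r ∣?_) {xs = divisors n} d∈′ =
      x
      , ∈-filter⁺ _ (∈-divisors⁺ (∣-trans (m∣m*n r) (∈-divisors⁻ d∈ds))) (r²∤d ∘ *-monoˡ-∣ r)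
      , ℕ.*-comm x r

  multiples-sum : sumOver multiples μ ≡ ℤ.- sumOver nonmultiples μ
  multiples-sum = begin
    sumOver multiples μ
      ≡⟨ sumOver-filter-¬ (r * r ∣?_) multiples μ ⟩
    sumOver (filter (r * r ∣?_) multiples) μ ℤ.+ sumOver simpleMultiples μ
      ≡⟨ cong (ℤ._+ sumOver simpleMultiples μ) (sumOver-zero (filter (r * r ∣?_) multiples) μ-vanishes) ⟩
    0ℤ ℤ.+ sumOver simpleMultiples μ
      ≡⟨ ℤ.+-identityˡ _ ⟩
    sumOver simpleMultiples μ
      ≡⟨ sumOver-↭ μ times-r-↭ ⟨
    sumOver (map (r *_) nonmultiples) μ
      ≡⟨ sumOver-map (r *_) nonmultiples μ ⟩
    sumOver nonmultiples (λ d → μ (r * d))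
      ≡⟨ sumOver-cong nonmultiples μ-negates ⟩
    sumOver nonmultiples (λ d → -1ℤ ℤ.* μ d)
      ≡⟨ sumOver-*ˡ nonmultiples -1ℤ μ ⟨
    -1ℤ ℤ.* sumOver nonmultiples μ
      ≡⟨ ℤ.-1*i≡-i _ ⟩
    ℤ.- sumOver nonmultiples μ ∎
    where
    μ-vanishes : ∀ {d} → d ∈ filter (r * r ∣?_) multiples → μ d ≡ 0ℤ
    μ-vanishes d∈ with d∈′ , r²∣d ← ∈-filter⁻ (r * r ∣?_) {xs = multiples} d∈
                  with d∈ds , _ ← ∈-filter⁻ (r ∣?_) {xs = divisors n} d∈′ =
      μ-square {{∣⇒nonZero (∈-divisors⁻ d∈ds)}} r-prime r²∣d

    μ-negates : ∀ {d} → d ∈ nonmultiples → μ (r * d) ≡ -1ℤ ℤ.* μ d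
    μ-negates {d} d∈ with d∣n , r∤d ← ∈-nonmultiples⁻ d∈ =
      trans (μ-prime-* r-prime r∤d {{∣⇒nonZero d∣n}}) (sym (ℤ.-1*i≡-i (μ d)))

-- Minimal periods

-- Indexed as in divisorSum: i stands for the divisor suc i.
predDivisors : ℕ → List ℕ
predDivisors k = filter (λ i → suc i ∣? k) (upTo k)

∈-predDivisors⁺ : ∀ {k i} .{{_ : NonZero k}} → suc i ∣ k → i ∈ predDivisors k
∈-predDivisors⁺ {k} i∣k = ∈-filter⁺ (λ i → suc i ∣? k) (∈-upTo⁺ (∣⇒≤ i∣k)) i∣k

∈-predDivisors⁻ : ∀ {k i} → i ∈ predDivisors k → suc i ∣ k
∈-predDivisors⁻ {k} = proj₂ ∘ ∈-filter⁻ (λ i → suc i ∣? k) {xs = upTo k}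

predDivisors-unique : ∀ k → Unique (predDivisors k)
predDivisors-unique k = Unique.filter⁺ (λ i → suc i ∣? k) (Unique.upTo⁺ k)

-- The shape copies `IsT`: when `A d` is `x ^ (e ^ d) ≡ x [mod n ]`, `Minimal A k` and `IsT n e k x`
-- agree definitionally, so `isT?` decides it.
Minimal : (ℕ → Set) → ℕ → Set
Minimal A k = A k × (∀ {m} → m < k → 0 < m → ¬ A m)

-- Strong induction: either no smaller positive number has the property, or the search restarts from
-- one. The bound `t ≤ k` is kept in order to obtain `t < k` once `t ≢ k`.
least : ∀ {A} → Decidable A → ∀ k → 0 < k → A k → ∃ λ t → 0 < t × t ≤ k × Minimal A t
least {A} A? = <-rec _ search
  where
  search : ∀ k → (∀ {j} → j < k → 0 < j → A j → ∃ λ t → 0 < t × t ≤ j × Minimal A t) →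
           0 < k → A k → ∃ λ t → 0 < t × t ≤ k × Minimal A t
  search k rec 0<k ak with ℕ.anyUpTo? (λ m → (0 ℕ.<? m) ×-dec A? m) k
  ... | no none = k , 0<k , ℕ.≤-refl , ak , λ m<k 0<m am → none (_ , m<k , 0<m , am)
  ... | yes (j , j<k , 0<j , aj) with t , 0<t , t≤j , min ← rec j<k 0<j aj =
    t , 0<t , ℕ.≤-trans t≤j (ℕ.<⇒≤ j<k) , min

-- These closure properties are all that is used of the set of periods; once it has a positive
-- member, they make it the set of multiples of the least one.
module _ {A : ℕ → Set} (A? : Decidable A) (A-zero : A 0)
         (A-+ : ∀ {a b} → A a → A b → A (a + b)) (A-+⁻ : ∀ {a b} → A a → A (a + b) → A b) where

  A-* : ∀ c {a} → A a → A (c * a)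
  A-* zero    aa = A-zero
  A-* (suc c) aa = A-+ aa (A-* c aa)

  A-∣ : ∀ {a b} → a ∣ b → A a → A b
  A-∣ (divides-refl c) = A-* c

  -- Division with remainder: cancelling the multiple `d / t * t` puts `d % t` in `A`, and as
  -- `d % t < t`, minimality forces it to be 0.
  period-∣ : ∀ {t d} .{{_ : NonZero t}} → Minimal A t → A d → t ∣ d
  period-∣ {t} {d} (at , minimal) ad with d % t in eq
  ... | zero  = m%n≡0⇒n∣m d t eq
  ... | suc r = contradiction (subst A eq a%) (minimal (subst (_< t) eq (m%n<n d t)) z<s)
    where
    a% : A (d % t)
    a% = A-+⁻ (A-* (d / t) at)
      (subst A (trans (m≡m%n+[m/n]*n d t) (ℕ.+-comm (d % t) (d / t * t))) ad)

  module _ {k t} .{{_ : NonZero k}} (0<t : 0 < t) (t-min : Minimal A t) (t∣k : t ∣ k) where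

    private
      instance
        t≢0 : NonZero t
        t≢0 = >-nonZero 0<t

        m≢0 : NonZero (quotient t∣k)
        m≢0 = quotient≢0 t∣k

      active : List ℕ
      active = filter (A? ∘ suc) (predDivisors k)

    -- The divisors of `k` lying in `A` are the `s * t` with `s` dividing `k / t`, and `k / (s * t)`
    -- is the divisor of `k / t` complementary to `s`.
    divisors-↭ : map (λ i → k / suc i) active ↭ divisors (quotient t∣k)
    divisors-↭ = map-↭ (Unique.filter⁺ (A? ∘ suc) (predDivisors-unique k))
                       (divisors-unique (quotient t∣k)) inj into onto
      where
      ∈⁻ : ∀ {i} → i ∈ active → suc i ∣ k × A (suc i)
      ∈⁻ i∈ with i∈′ , a ← ∈-filter⁻ (A? ∘ suc) {xs = predDivisors k} i∈ = ∈-predDivisors⁻ i∈′ , a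

      inj : ∀ {i j} → i ∈ active → j ∈ active → k / suc i ≡ k / suc j → i ≡ j
      inj {i} {j} i∈ j∈ eq with i∣k , _ ← ∈⁻ i∈ | j∣k , _ ← ∈⁻ j∈ =
        ℕ.suc-injective (ℕ.*-cancelˡ-≡ (suc i) (suc j) (k / suc i) {{∣⇒nonZero (m/n∣m i∣k)}}
          (trans (m/n*n≡m i∣k) (trans (sym (m/n*n≡m j∣k)) (cong (_* suc j) (sym eq)))))

      into : ∀ {i} → i ∈ active → k / suc i ∈ divisors (quotient t∣k)
      into {i} i∈ with i∣k , a ← ∈⁻ i∈ = ∈-divisors⁺ {quotient t∣k} (*-cancelʳ-∣ t
        (subst (k / suc i * t ∣_) (trans (m/n*n≡m i∣k) (m∣n⇒n≡quotient*m t∣k))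
          (*-monoʳ-∣ (k / suc i) (period-∣ t-min a))))

      onto : ∀ {c} → c ∈ divisors (quotient t∣k) → ∃ λ i → i ∈ active × c ≡ k / suc i
      -- With `k / t` equal to `s * c`, the divisor sent to `c` is `s * t`. It is passed on as a
      -- separate number so that it can be matched as a successor, the list holding its predecessor.
      onto {c} c∈ with divides s m≡sc ← ∈-divisors⁻ {quotient t∣k} c∈ = preimage (s * t) refl
        where
        k≡ : k ≡ c * (s * t)
        k≡ = trans (m∣n⇒n≡quotient*m t∣k) (trans (cong (_* t) m≡sc) (rearrange s c t))
          where
          rearrange : ∀ s c t → s * c * t ≡ c * (s * t)
          rearrange = ℕ-Solver.solve-∀

        preimage : ∀ d → d ≡ s * t → ∃ λ i → i ∈ active × c ≡ k / suc i
        preimage zero    0≡st = contradiction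
          (trans k≡ (trans (cong (c *_) (sym 0≡st)) (ℕ.*-zeroʳ c))) (≢-nonZero⁻¹ k)
        preimage (suc i) i≡st =
          i
          , ∈-filter⁺ (A? ∘ suc) (∈-predDivisors⁺ (divides c k≡′)) (subst A (sym i≡st) (A-* s (proj₁ t-min)))
          , sym (trans (cong (_/ suc i) k≡′) (m*n/n≡m c (suc i)))
          where
          k≡′ : k ≡ c * suc i
          k≡′ = trans k≡ (cong (c *_) (sym i≡st))

  -- If `k` is not in `A`, no divisor of `k` is, and both sides vanish. Otherwise the terms that
  -- survive form the sum of `μ` over the divisors of `k / t`, which is 1 or 0 according to whether
  -- `t` equals `k`. The decision `min?` is arbitrary so that `isT?` can be supplied.
  möbius-minimal : ∀ k .{{_ : NonZero k}} (min? : Dec (Minimal A k)) →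
    sumOver (predDivisors k) (λ i → μ (k / suc i) ℤ.* ⟦ A? (suc i) ⟧) ≡ ⟦ min? ⟧
  möbius-minimal k min? with A? k
  ... | no ¬ak = trans
    (sumOver-zero (predDivisors k) λ {i} i∈ → trans
      (cong (μ (k / suc i) ℤ.*_) (⟦⟧-no (A? (suc i)) (¬ak ∘ A-∣ (∈-predDivisors⁻ i∈))))
      (ℤ.*-zeroʳ (μ (k / suc i))))
    (sym (⟦⟧-no min? (¬ak ∘ proj₁)))
  ... | yes ak with t , 0<t , t≤k , t-min ← least A? k (>-nonZero⁻¹ k) ak
               with t∣k ← period-∣ {{>-nonZero 0<t}} t-min ak = begin
    sumOver (predDivisors k) (λ i → μ (k / suc i) ℤ.* ⟦ A? (suc i) ⟧)
      ≡⟨ sumOver-filter (A? ∘ suc) (predDivisors k) _ ⟨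
    sumOver (filter (A? ∘ suc) (predDivisors k)) (λ i → μ (k / suc i))
      ≡⟨ sumOver-map (λ i → k / suc i) (filter (A? ∘ suc) (predDivisors k)) μ ⟨
    sumOver (map (λ i → k / suc i) (filter (A? ∘ suc) (predDivisors k))) μ
      ≡⟨ sumOver-↭ μ (divisors-↭ 0<t t-min t∣k) ⟩
    sumOver (divisors (quotient t∣k)) μ
      ≡⟨ indicator ⟩
    ⟦ min? ⟧ ∎
    where
    open ≡-Reasoning

    indicator : sumOver (divisors (quotient t∣k)) μ ≡ ⟦ min? ⟧
    indicator with quotient t∣k ℕ.≟ 1
    -- At `m = 1` the sum is a closed term that evaluates to `1ℤ`.
    ... | yes m≡1 = trans (cong (λ m → sumOver (divisors m) μ) m≡1) (sym (⟦⟧-yes min? k-min))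
      where
      k-min : Minimal A k
      k-min = subst (Minimal A)
        (sym (trans (m∣n⇒n≡quotient*m t∣k) (trans (cong (_* t) m≡1) (ℕ.*-identityˡ t)))) t-min
    ... | no m≢1 = trans (sumOver-μ-divisors (quotient t∣k) {{quotient≢0 t∣k}} m≢1)
      (sym (⟦⟧-no min? λ (_ , minimal) → minimal (ℕ.≤∧≢⇒< t≤k t≢k) 0<t (proj₁ t-min)))
      where
      t≢k : t ≢ k
      t≢k t≡k = m≢1 (ℕ.*-cancelʳ-≡ _ 1 t {{>-nonZero 0<t}}
        (trans (sym (m∣n⇒n≡quotient*m t∣k)) (trans (sym t≡k) (sym (ℕ.*-identityˡ t)))))

-- Arithmetic modulo n

coprime-* : ∀ {a b n} → Coprime a n → Coprime b n → Coprime (a * b) n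
coprime-* a⊥n b⊥n (i∣ab , i∣n) =
  b⊥n (coprime-divisor (λ (j∣i , j∣a) → a⊥n (j∣a , ∣-trans j∣i i∣n)) i∣ab , i∣n)

coprime-∣ʳ : ∀ {a m n} → m ∣ n → Coprime a n → Coprime a m
coprime-∣ʳ m∣n a⊥n (i∣a , i∣m) = a⊥n (i∣a , ∣-trans i∣m m∣n)

coprime-product : ∀ {n} {xs : List ℕ} → All (λ x → Coprime x n) xs → Coprime (product xs) n
coprime-product []         = Coprime.1-coprimeTo _
coprime-product (x⊥n ∷ xs⊥n) = coprime-* x⊥n (coprime-product xs⊥n)

mod-∣ : ∀ {a b m n} → m ∣ n → a ≡ b [mod n ] → a ≡ b [mod m ]
mod-∣ = ∣-trans

mod-cancelˡ : ∀ {a b n} x → Coprime x n → x * a ≡ x * b [mod n ] → a ≡ b [mod n ]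
mod-cancelˡ {a} {b} x x⊥n =
  coprime-divisor (Coprime.sym x⊥n) ∘ subst (_ ∣_) (sym (ℕ.*-distribˡ-∣-∣ x a b))

module _ {n} .{{_ : NonZero n}} where

  coprime-% : ∀ {a} → Coprime a n → Coprime (a % n) n
  coprime-% a⊥n (i∣a% , i∣n) = a⊥n (∣n∣m%n⇒∣m i∣n i∣a% , i∣n)

  coprime-%⁻ : ∀ {a} → Coprime (a % n) n → Coprime a n
  coprime-%⁻ a%⊥n (i∣a , i∣n) = a%⊥n (%-presˡ-∣ i∣a i∣n , i∣n)

  -- Equality of remainders is propositional equality, so `cong` and `trans` apply; most
  -- calculations are done in that form and returned through `%⇒mod`.
  mod⇒% : ∀ a b → a ≡ b [mod n ] → a % n ≡ b % n
  mod⇒% a b a≡b with ℕ.≤-total a b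
  ... | inj₁ a≤b = sym (lemma a≤b (subst (n ∣_) (ℕ.m≤n⇒∣m-n∣≡n∸m a≤b) a≡b))
    where
    lemma : ∀ {a b} → a ≤ b → n ∣ b ∸ a → b % n ≡ a % n
    lemma {a} {b} a≤b n∣b∸a = trans (cong (_% n) (sym (ℕ.m+[n∸m]≡n a≤b))) (%-remove-+ʳ a n∣b∸a)
  ... | inj₂ b≤a = trans (cong (_% n) (sym (ℕ.m+[n∸m]≡n b≤a)))
                         (%-remove-+ʳ b (subst (n ∣_) (ℕ.m≤n⇒∣n-m∣≡n∸m b≤a) a≡b))

  %⇒mod : ∀ a b → a % n ≡ b % n → a ≡ b [mod n ]
  %⇒mod a b a%≡b% = divides ∣ a / n - b / n ∣ (begin
    ∣ a - b ∣
      ≡⟨ cong₂ ∣_-_∣ (m≡m%n+[m/n]*n a n) (trans (m≡m%n+[m/n]*n b n) (cong (_+ b / n * n) (sym a%≡b%))) ⟩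
    ∣ a % n + a / n * n - a % n + b / n * n ∣
      ≡⟨ ℕ.∣m+n-m+o∣≡∣n-o∣ (a % n) _ _ ⟩
    ∣ a / n * n - b / n * n ∣
      ≡⟨ ℕ.*-distribʳ-∣-∣ n (a / n) (b / n) ⟨
    ∣ a / n - b / n ∣ * n ∎)
    where open ≡-Reasoning

  %-cong-* : ∀ a b c d → a % n ≡ b % n → c % n ≡ d % n → (a * c) % n ≡ (b * d) % n
  %-cong-* a b c d a≡b c≡d = trans (%-distribˡ-* a c n)
    (trans (cong₂ (λ s t → (s * t) % n) a≡b c≡d) (sym (%-distribˡ-* b d n)))

  %-cong-^ : ∀ a b k → a % n ≡ b % n → (a ^ k) % n ≡ (b ^ k) % n
  %-cong-^ a b zero    a≡b = refl
  %-cong-^ a b (suc k) a≡b = %-cong-* a b (a ^ k) (b ^ k) a≡b (%-cong-^ a b k a≡b)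

  inverse : ∀ {x} → Coprime x n → ∃ λ y → (x * y) % n ≡ 1 % n
  inverse {x} x⊥n with coprime-Bézout x⊥n
  ... | Bézout.+- y b 1+bn≡yx = y ,
    trans (cong (_% n) (trans (ℕ.*-comm x y) (sym 1+bn≡yx))) ([m+kn]%n≡m%n 1 b n)
  -- Here x * y ≡ -1, so squaring gives 1.
  ... | Bézout.-+ y b 1+yx≡bn = y * (y * x) , (begin
    -- Adding the multiple `b * n`, which is `1 + y * x`, avoids subtraction: the total is 1 plus a
    -- multiple of `1 + y * x`.
    (x * (y * (y * x))) % n                     ≡⟨ [m+kn]%n≡m%n _ b n ⟨
    (x * (y * (y * x)) + b * n) % n             ≡⟨ cong (λ t → (x * (y * (y * x)) + t) % n) 1+yx≡bn ⟨
    (x * (y * (y * x)) + (1 + y * x)) % n       ≡⟨ cong (_% n) (square x y) ⟩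
    (1 + (1 + y * x) * (y * x)) % n             ≡⟨ cong (λ t → (1 + t * (y * x)) % n) 1+yx≡bn ⟩
    (1 + b * n * (y * x)) % n                   ≡⟨ cong (λ t → (1 + t) % n) (rearrange b n (y * x)) ⟩
    (1 + b * (y * x) * n) % n                   ≡⟨ [m+kn]%n≡m%n 1 (b * (y * x)) n ⟩
    1 % n                                       ∎)
    where
    open ≡-Reasoning

    square : ∀ x y → x * (y * (y * x)) + (1 + y * x) ≡ 1 + (1 + y * x) * (y * x)
    square = ℕ-Solver.solve-∀

    rearrange : ∀ b n z → b * n * z ≡ b * z * n
    rearrange = ℕ-Solver.solve-∀

  inverse-coprime : ∀ x {y} → (x * y) % n ≡ 1 % n → Coprime y n
  inverse-coprime x xy≡1 (i∣y , i∣n) = ∣1⇒≡1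
    (∣n∣m%n⇒∣m i∣n (subst (_ ∣_) xy≡1 (%-presˡ-∣ (∣n⇒∣m*n x i∣y) i∣n)))

-- Reduced residues and Euler's theorem

∈-ℤ*⁺ : ∀ {n x} → x < n → Coprime x n → x ∈ ℤ* n
∈-ℤ*⁺ {n} x<n x⊥n = ∈-filter⁺ (λ x → coprime? x n) (∈-upTo⁺ x<n) x⊥n

∈-ℤ*⁻ : ∀ {n x} → x ∈ ℤ* n → x < n × Coprime x n
∈-ℤ*⁻ {n} x∈ with x∈′ , x⊥n ← ∈-filter⁻ (λ x → coprime? x n) {xs = upTo n} x∈ = ∈-upTo⁻ x∈′ , x⊥n

ℤ*-unique : ∀ n → Unique (ℤ* n)
ℤ*-unique n = Unique.filter⁺ (λ x → coprime? x n) (Unique.upTo⁺ n)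

module _ {n} .{{_ : NonZero n}} {x} (x⊥n : Coprime x n) where

  -- Multiplication by `x` is injective because `x` cancels, and onto because `z` comes from
  -- `x⁻¹ * z`.
  ℤ*-*-↭ : map (λ y → (x * y) % n) (ℤ* n) ↭ ℤ* n
  ℤ*-*-↭ = map-↭ (ℤ*-unique n) (ℤ*-unique n) inj into onto
    where
    inj : ∀ {y z} → y ∈ ℤ* n → z ∈ ℤ* n → (x * y) % n ≡ (x * z) % n → y ≡ z
    inj {y} {z} y∈ z∈ eq = begin
      y     ≡⟨ m<n⇒m%n≡m (proj₁ (∈-ℤ*⁻ y∈)) ⟨
      y % n ≡⟨ mod⇒% y z (mod-cancelˡ {y} {z} x x⊥n (%⇒mod (x * y) (x * z) eq)) ⟩
      z % n ≡⟨ m<n⇒m%n≡m (proj₁ (∈-ℤ*⁻ z∈)) ⟩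
      z     ∎
      where open ≡-Reasoning

    into : ∀ {y} → y ∈ ℤ* n → (x * y) % n ∈ ℤ* n
    into {y} y∈ = ∈-ℤ*⁺ (m%n<n (x * y) n) (coprime-% (coprime-* x⊥n (proj₂ (∈-ℤ*⁻ y∈))))

    onto : ∀ {z} → z ∈ ℤ* n → ∃ λ y → y ∈ ℤ* n × z ≡ (x * y) % n
    onto {z} z∈ with z<n , z⊥n ← ∈-ℤ*⁻ z∈ | x⁻¹ , xx⁻¹≡1 ← inverse x⊥n =
      (x⁻¹ * z) % n , ∈-ℤ*⁺ (m%n<n (x⁻¹ * z) n) (coprime-% x⁻¹z⊥n) , (begin
      z                       ≡⟨ m<n⇒m%n≡m z<n ⟨
      z % n                   ≡⟨ cong (_% n) (ℕ.*-identityˡ z) ⟨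
      (1 * z) % n             ≡⟨ %-cong-* (x * x⁻¹) 1 z z xx⁻¹≡1 refl ⟨
      (x * x⁻¹ * z) % n       ≡⟨ cong (_% n) (ℕ.*-assoc x x⁻¹ z) ⟩
      (x * (x⁻¹ * z)) % n     ≡⟨ %-cong-* x x (x⁻¹ * z % n) (x⁻¹ * z) refl (m%n%n≡m%n (x⁻¹ * z) n) ⟨
      (x * (x⁻¹ * z % n)) % n ∎)
      where
      open ≡-Reasoning
      x⁻¹z⊥n : Coprime (x⁻¹ * z) n
      x⁻¹z⊥n = coprime-* (inverse-coprime x xx⁻¹≡1) z⊥n

  product-* : ∀ ys → product (map (λ y → (x * y) % n) ys) % n ≡ (x ^ length ys * product ys) % n
  product-* []       = refl
  product-* (y ∷ ys) = begin
    ((x * y) % n * product (map (λ y → (x * y) % n) ys)) % n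
      ≡⟨ %-cong-* ((x * y) % n) (x * y) _ (x ^ length ys * product ys) (m%n%n≡m%n (x * y) n) (product-* ys) ⟩
    (x * y * (x ^ length ys * product ys)) % n
      ≡⟨ cong (_% n) (interchange x y (x ^ length ys) (product ys)) ⟩
    (x ^ suc (length ys) * (y * product ys)) % n ∎
    where
    open ≡-Reasoning
    interchange : ∀ a b c d → a * b * (c * d) ≡ a * c * (b * d)
    interchange = ℕ-Solver.solve-∀

  -- Multiplication by `x` permutes `ℤ* n`, so the product of all entries is unchanged modulo `n`
  -- when multiplied by `x ^ φ n`. That product is coprime to `n` and cancels.
  euler : x ^ φ n ≡ 1 [mod n ]
  euler = mod-cancelˡ {x ^ φ n} {1} (product (ℤ* n))
    (coprime-product (All.tabulate (proj₂ ∘ ∈-ℤ*⁻)))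
    (%⇒mod (product (ℤ* n) * x ^ φ n) (product (ℤ* n) * 1) (begin
      (product (ℤ* n) * x ^ φ n) % n                  ≡⟨ cong (_% n) (ℕ.*-comm (product (ℤ* n)) (x ^ φ n)) ⟩
      (x ^ φ n * product (ℤ* n)) % n                  ≡⟨ product-* (ℤ* n) ⟨
      product (map (λ y → (x * y) % n) (ℤ* n)) % n    ≡⟨ cong (_% n) (product-↭ ℤ*-*-↭) ⟩
      product (ℤ* n) % n                              ≡⟨ cong (_% n) (ℕ.*-identityʳ (product (ℤ* n))) ⟨
      (product (ℤ* n) * 1) % n                        ∎))
    where open ≡-Reasoning

φ-prime : ∀ {p} → Prime p → φ p ≡ p ∸ 1
φ-prime {zero}  p-prime = contradiction p-prime ¬prime[0]
φ-prime {suc p} p-prime = trans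
  (Permutation.↭-length (unique-↭ (ℤ*-unique (suc p))
    (Unique.map⁺ ℕ.suc-injective (Unique.upTo⁺ p)) to from))
  (trans (length-map suc (upTo p)) (length-upTo p))
  where
  to : ∀ {x} → x ∈ ℤ* (suc p) → x ∈ map suc (upTo p)
  -- If 0 were coprime to `suc p`, then `suc p` would be 1, which is not prime.
  to {zero}  x∈ = contradiction (subst Prime (Coprime.0-coprimeTo-m⇒m≡1 (proj₂ (∈-ℤ*⁻ x∈))) p-prime) ¬prime[1]
  to {suc x} x∈ = ∈-map⁺ suc (∈-upTo⁺ (s<s⁻¹ (proj₁ (∈-ℤ*⁻ x∈))))

  from : ∀ {x} → x ∈ map suc (upTo p) → x ∈ ℤ* (suc p)
  from x∈ with y , y∈ , refl ← ∈-map⁻ suc x∈ =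
    ∈-ℤ*⁺ (s<s (∈-upTo⁻ y∈)) (Coprime.sym (Coprime.prime⇒coprime p-prime (s<s (∈-upTo⁻ y∈))))

-- Roots of unity and the Chinese remainder theorem

roots : ℕ → ℕ → List ℕ
roots n m = filter (λ x → x ^ m ≡? 1 [mod n ]) (ℤ* n)

∈-roots⁺ : ∀ n m {x} → x < n → Coprime x n → x ^ m ≡ 1 [mod n ] → x ∈ roots n m
∈-roots⁺ n m x<n x⊥n = ∈-filter⁺ (λ x → x ^ m ≡? 1 [mod n ]) (∈-ℤ*⁺ x<n x⊥n)

∈-roots⁻ : ∀ n m {x} → x ∈ roots n m → x < n × Coprime x n × x ^ m ≡ 1 [mod n ]
∈-roots⁻ n m x∈ with x∈′ , x^m≡1 ← ∈-filter⁻ (λ x → x ^ m ≡? 1 [mod n ]) {xs = ℤ* n} x∈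
                    with x<n , x⊥n ← ∈-ℤ*⁻ x∈′ = x<n , x⊥n , x^m≡1

roots-unique : ∀ n m → Unique (roots n m)
roots-unique n m = Unique.filter⁺ (λ x → x ^ m ≡? 1 [mod n ]) (ℤ*-unique n)

module _ {p q} .{{_ : NonZero p}} .{{_ : NonZero q}} (p⊥q : Coprime p q) (m : ℕ) where

  private
    instance
      pq≢0 : NonZero (p * q)
      pq≢0 = ℕ.m*n≢0 p q

  roots-reduce : ∀ {x r n} .{{_ : NonZero r}} → r ∣ n → x ∈ roots n m → x % r ∈ roots r m
  roots-reduce {x} {r} {n} r∣n x∈ with _ , x⊥n , x^m≡1 ← ∈-roots⁻ n m x∈ =
    ∈-roots⁺ r m (m%n<n x r) (coprime-% (coprime-∣ʳ r∣n x⊥n))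
      (%⇒mod ((x % r) ^ m) 1 (trans (%-cong-^ (x % r) x m (m%n%n≡m%n x r))
                                    (mod⇒% (x ^ m) 1 (mod-∣ {x ^ m} {1} r∣n x^m≡1))))

  crt : ∀ b c → ∃ λ x → x < p * q × x % p ≡ b % p × x % q ≡ c % q
  crt b c with u , pu≡1 ← inverse p⊥q | v , qv≡1 ← inverse (Coprime.sym p⊥q) =
    x % (p * q) , m%n<n x (p * q)
    , trans (m∣n⇒o%n%m≡o%m p (p * q) x (m∣m*n q))
        (trans (%-remove-+ʳ (b * (q * v)) (∣n⇒∣m*n c (m∣m*n u)))
               (trans (%-cong-* b b (q * v) 1 refl qv≡1) (cong (_% p) (ℕ.*-identityʳ b))))
    , trans (m∣n⇒o%n%m≡o%m q (p * q) x (n∣m*n p))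
        (trans (%-remove-+ˡ (c * (p * u)) (∣n⇒∣m*n b (m∣m*n v)))
               (trans (%-cong-* c c (p * u) 1 refl pu≡1) (cong (_% q) (ℕ.*-identityʳ c))))
    where
    x : ℕ
    -- `q * v` is 1 modulo `p` and 0 modulo `q`, while `p * u` is 0 modulo `p` and 1 modulo `q`.
    x = b * (q * v) + c * (p * u)

  length-roots-* : length (roots (p * q) m) ≡ length (roots p m) * length (roots q m)
  length-roots-* = trans (sym (length-map residues (roots (p * q) m)))
    (trans (Permutation.↭-length residues-↭) (length-cartesianProduct (roots p m) (roots q m)))
    where
    residues : ℕ → ℕ × ℕ
    residues x = x % p , x % q

    residues-↭ : map residues (roots (p * q) m) ↭ cartesianProduct (roots p m) (roots q m)
    residues-↭ = map-↭ (roots-unique (p * q) m)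
      (Unique.cartesianProduct⁺ (roots-unique p m) (roots-unique q m)) inj into onto
      where
      inj : ∀ {x y} → x ∈ roots (p * q) m → y ∈ roots (p * q) m → residues x ≡ residues y → x ≡ y
      inj {x} {y} x∈ y∈ eq = begin
        x           ≡⟨ m<n⇒m%n≡m (proj₁ (∈-roots⁻ (p * q) m x∈)) ⟨
        x % (p * q) ≡⟨ mod⇒% x y (coprime⇒*-∣ p⊥q (%⇒mod x y (cong proj₁ eq)) (%⇒mod x y (cong proj₂ eq))) ⟩
        y % (p * q) ≡⟨ m<n⇒m%n≡m (proj₁ (∈-roots⁻ (p * q) m y∈)) ⟩
        y           ∎
        where open ≡-Reasoning

      into : ∀ {x} → x ∈ roots (p * q) m → residues x ∈ cartesianProduct (roots p m) (roots q m)
      into x∈ = ∈-cartesianProduct⁺ (roots-reduce (m∣m*n q) x∈) (roots-reduce (n∣m*n p) x∈)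

      onto : ∀ {bc} → bc ∈ cartesianProduct (roots p m) (roots q m) →
             ∃ λ x → x ∈ roots (p * q) m × bc ≡ residues x
      onto {b , c} bc∈ with b∈ , c∈ ← ∈-cartesianProduct⁻ (roots p m) (roots q m) bc∈
        with b<p , b⊥p , b^m≡1 ← ∈-roots⁻ p m b∈ | c<q , c⊥q , c^m≡1 ← ∈-roots⁻ q m c∈
           | x , x<pq , x≡b , x≡c ← crt b c =
        x
        , ∈-roots⁺ (p * q) m x<pq (Coprime.sym
            (coprime-* (coprime-residue x≡b b⊥p) (coprime-residue x≡c c⊥q)))
            (coprime⇒*-∣ p⊥q (root-residue {x} {b} x≡b b^m≡1) (root-residue {x} {c} x≡c c^m≡1))
        , sym (cong₂ _,_ (trans x≡b (m<n⇒m%n≡m b<p)) (trans x≡c (m<n⇒m%n≡m c<q)))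
        where
        coprime-residue : ∀ {x b r} .{{_ : NonZero r}} → x % r ≡ b % r → Coprime b r → Coprime r x
        coprime-residue {r = r} x≡b b⊥r = Coprime.sym
          (coprime-%⁻ (subst (λ t → Coprime t r) (sym x≡b) (coprime-% b⊥r)))

        root-residue : ∀ {x b r} .{{_ : NonZero r}} → x % r ≡ b % r → b ^ m ≡ 1 [mod r ] → x ^ m ≡ 1 [mod r ]
        root-residue {x} {b} x≡b b^m≡1 =
          %⇒mod (x ^ m) 1 (trans (%-cong-^ x b m x≡b) (mod⇒% (b ^ m) 1 b^m≡1))

-- Roots of unity modulo a prime

∣⊖∣≡∣-∣ : ∀ a b → ℤ.∣ a ℤ.⊖ b ∣ ≡ ∣ a - b ∣
∣⊖∣≡∣-∣ zero    zero    = refl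
∣⊖∣≡∣-∣ zero    (suc b) = refl
∣⊖∣≡∣-∣ (suc a) zero    = refl
∣⊖∣≡∣-∣ (suc a) (suc b) = trans (cong ℤ.∣_∣ (ℤ.[1+m]⊖[1+n]≡m⊖n a b)) (∣⊖∣≡∣-∣ a b)

∣-∣≡∣ℤ-∣ : ∀ a b → ∣ a - b ∣ ≡ ℤ.∣ + a ℤ.- + b ∣
∣-∣≡∣ℤ-∣ a b = sym (trans (cong ℤ.∣_∣ (ℤ.m-n≡m⊖n a b)) (∣⊖∣≡∣-∣ a b))

-- Polynomials and their factorisations need subtraction, so roots are counted over `ℤ`; this and
-- its converse carry congruences across.
mod⇒ℤ∣ : ∀ {n} a b → a ≡ b [mod n ] → + n ℤ.∣ + a ℤ.- + b
mod⇒ℤ∣ a b a≡b = ℤ.∣ᵤ⇒∣ (subst (_ ∣_) (∣-∣≡∣ℤ-∣ a b) a≡b)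

ℤ∣⇒mod : ∀ {n} a b → + n ℤ.∣ + a ℤ.- + b → a ≡ b [mod n ]
ℤ∣⇒mod a b n∣a-b = subst (_ ∣_) (sym (∣-∣≡∣ℤ-∣ a b)) (ℤ.∣⇒∣ᵤ n∣a-b)

euclidsLemmaℤ : ∀ {p} → Prime p → ∀ i j → + p ℤ.∣ i ℤ.* j → + p ℤ.∣ i ⊎ + p ℤ.∣ j
euclidsLemmaℤ p-prime i j p∣ij = Sum.map ℤ.∣ᵤ⇒∣ ℤ.∣ᵤ⇒∣
  (euclidsLemma ℤ.∣ i ∣ ℤ.∣ j ∣ p-prime (subst (_ ∣_) (ℤ.abs-* i j) (ℤ.∣⇒∣ᵤ p∣ij)))

pos-^ : ∀ a k → + (a ^ k) ≡ (+ a) ℤ.^ k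
pos-^ a zero    = refl
pos-^ a (suc k) = trans (ℤ.pos-* a (a ^ k)) (cong (+ a ℤ.*_) (pos-^ a k))

-- A vector of length d holds the lower coefficients, constant term first, of a monic polynomial
-- of degree d.
eval : ∀ {d} → Vec ℤ d → ℤ → ℤ
eval []       x = 1ℤ
eval (c ∷ cs) x = c ℤ.+ x ℤ.* eval cs x

-- Synthetic division by `X - a`, with the remainder dropped. If `F` has quotient `G`, then
-- `c + X * F` has quotient `F a + X * G`. The leading 1 is implicit, so the quotient of a linear
-- polynomial is the empty vector, the constant 1.
quotientBy : ∀ {d} → ℤ → Vec ℤ (suc d) → Vec ℤ d
quotientBy a (c ∷ [])         = []
quotientBy a (c ∷ cs@(_ ∷ _)) = eval cs a ∷ quotientBy a cs

eval-quotientBy : ∀ {d} a (cs : Vec ℤ (suc d)) x →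
                  eval cs x ℤ.- eval cs a ≡ (x ℤ.- a) ℤ.* eval (quotientBy a cs) x
eval-quotientBy a (c ∷ []) x = linear a c x
  where
  linear : ∀ a c x → c ℤ.+ x ℤ.* 1ℤ ℤ.- (c ℤ.+ a ℤ.* 1ℤ) ≡ (x ℤ.- a) ℤ.* 1ℤ
  linear = ℤ-Solver.solve-∀
eval-quotientBy a (c ∷ cs@(_ ∷ _)) x = begin
  c ℤ.+ x ℤ.* F x ℤ.- (c ℤ.+ a ℤ.* F a)
    ≡⟨ expand a c x (F x) (F a) ⟩
  x ℤ.* (F x ℤ.- F a) ℤ.+ (x ℤ.- a) ℤ.* F a
    ≡⟨ cong (λ t → x ℤ.* t ℤ.+ (x ℤ.- a) ℤ.* F a) (eval-quotientBy a cs x) ⟩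
  x ℤ.* ((x ℤ.- a) ℤ.* G x) ℤ.+ (x ℤ.- a) ℤ.* F a
    ≡⟨ collect a x (F a) (G x) ⟩
  (x ℤ.- a) ℤ.* (F a ℤ.+ x ℤ.* G x) ∎
  where
  open ≡-Reasoning
  F G : ℤ → ℤ
  F = eval cs
  G = eval (quotientBy a cs)

  expand : ∀ a c x s t → c ℤ.+ x ℤ.* s ℤ.- (c ℤ.+ a ℤ.* t) ≡ x ℤ.* (s ℤ.- t) ℤ.+ (x ℤ.- a) ℤ.* t
  expand = ℤ-Solver.solve-∀

  collect : ∀ a x t u → x ℤ.* ((x ℤ.- a) ℤ.* u) ℤ.+ (x ℤ.- a) ℤ.* t ≡ (x ℤ.- a) ℤ.* (t ℤ.+ x ℤ.* u)
  collect = ℤ-Solver.solve-∀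

-- Dividing by `X - x` for one root `x` lowers the degree by one. For any other root `y`, `p`
-- divides `f y - f x`, which is `y - x` times the value of the quotient at `y`, and by Euclid's
-- lemma it divides that value. In degree 0 the polynomial is 1, which has no root modulo `p`.
lagrange : ∀ {p d} → Prime p → (cs : Vec ℤ d) (xs : List ℤ) →
           AllPairs (λ x y → ¬ + p ℤ.∣ y ℤ.- x) xs → All (λ x → + p ℤ.∣ eval cs x) xs →
           length xs ≤ d
lagrange p-prime cs       []       _ _ = z≤n
lagrange p-prime []       (x ∷ xs) _ (p∣1 ∷ _) =
  contradiction (subst Prime (∣1⇒≡1 (ℤ.∣⇒∣ᵤ p∣1)) p-prime) ¬prime[1]
lagrange {p} p-prime cs@(_ ∷ _) (x ∷ xs) (x≢ ∷ xs≢) (p∣fx ∷ p∣f) =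
  s≤s (lagrange p-prime (quotientBy x cs) xs xs≢ (All.zipWith root (x≢ , p∣f)))
  where
  root : ∀ {y} → (¬ + p ℤ.∣ y ℤ.- x) × + p ℤ.∣ eval cs y → + p ℤ.∣ eval (quotientBy x cs) y
  root {y} (p∤y-x , p∣fy) = [ (λ p∣y-x → contradiction p∣y-x p∤y-x) , id ]′
    (euclidsLemmaℤ p-prime (y ℤ.- x) (eval (quotientBy x cs) y)
      (subst (+ p ℤ.∣_) (eval-quotientBy x cs y) (ℤ.∣m∣n⇒∣m-n p∣fy p∣fx)))

eval-monomial-++ : ∀ k {d} (cs : Vec ℤ d) x → eval (replicate k 0ℤ ++ cs) x ≡ x ℤ.^ k ℤ.* eval cs x
eval-monomial-++ zero    cs x = sym (ℤ.*-identityˡ _)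
eval-monomial-++ (suc k) cs x = begin
  0ℤ ℤ.+ x ℤ.* eval (replicate k 0ℤ ++ cs) x ≡⟨ ℤ.+-identityˡ _ ⟩
  x ℤ.* eval (replicate k 0ℤ ++ cs) x        ≡⟨ cong (x ℤ.*_) (eval-monomial-++ k cs x) ⟩
  x ℤ.* (x ℤ.^ k ℤ.* eval cs x)              ≡⟨ ℤ.*-assoc x (x ℤ.^ k) (eval cs x) ⟨
  x ℤ.* x ℤ.^ k ℤ.* eval cs x                ∎
  where open ≡-Reasoning

-- 1 + y + ⋯ + y ^ s with y = x ^ suc g.
geometric : ∀ g s → Vec ℤ (s * suc g)
geometric g zero    = []
geometric g (suc s) = 1ℤ ∷ replicate g 0ℤ ++ geometric g s

-- Induction on `s`: if `H` is the shorter sum, `(y - 1) * (1 + y * H)` is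
-- `y * ((y - 1) * H) + (y - 1)`, to which the hypothesis applies.
eval-geometric : ∀ g s x →
                 (x ℤ.^ suc g ℤ.- 1ℤ) ℤ.* eval (geometric g s) x ≡ x ℤ.^ (suc s * suc g) ℤ.- 1ℤ
eval-geometric g zero x =
  trans (ℤ.*-identityʳ _) (cong (λ k → x ℤ.^ k ℤ.- 1ℤ) (sym (ℕ.*-identityˡ (suc g))))
eval-geometric g (suc s) x = begin
  (y ℤ.- 1ℤ) ℤ.* (1ℤ ℤ.+ x ℤ.* eval (replicate g 0ℤ ++ geometric g s) x)
    ≡⟨ cong (λ t → (y ℤ.- 1ℤ) ℤ.* (1ℤ ℤ.+ x ℤ.* t)) (eval-monomial-++ g (geometric g s) x) ⟩
  (y ℤ.- 1ℤ) ℤ.* (1ℤ ℤ.+ x ℤ.* (x ℤ.^ g ℤ.* H))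
    ≡⟨ telescope x (x ℤ.^ g) H ⟩
  y ℤ.* ((y ℤ.- 1ℤ) ℤ.* H) ℤ.+ (y ℤ.- 1ℤ)
    ≡⟨ cong (λ t → y ℤ.* t ℤ.+ (y ℤ.- 1ℤ)) (eval-geometric g s x) ⟩
  y ℤ.* (x ℤ.^ (suc s * suc g) ℤ.- 1ℤ) ℤ.+ (y ℤ.- 1ℤ)
    ≡⟨ collect y (x ℤ.^ (suc s * suc g)) ⟩
  y ℤ.* x ℤ.^ (suc s * suc g) ℤ.- 1ℤ
    ≡⟨ cong (ℤ._- 1ℤ) (ℤ.^-distribˡ-+-* x (suc g) (suc s * suc g)) ⟨
  x ℤ.^ (suc (suc s) * suc g) ℤ.- 1ℤ ∎
  where
  open ≡-Reasoning
  y H : ℤ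
  y = x ℤ.^ suc g
  H = eval (geometric g s) x

  telescope : ∀ x z h → (x ℤ.* z ℤ.- 1ℤ) ℤ.* (1ℤ ℤ.+ x ℤ.* (z ℤ.* h)) ≡
                        x ℤ.* z ℤ.* ((x ℤ.* z ℤ.- 1ℤ) ℤ.* h) ℤ.+ (x ℤ.* z ℤ.- 1ℤ)
  telescope = ℤ-Solver.solve-∀

  collect : ∀ y t → y ℤ.* (t ℤ.- 1ℤ) ℤ.+ (y ℤ.- 1ℤ) ≡ y ℤ.* t ℤ.- 1ℤ
  collect = ℤ-Solver.solve-∀

%-root-* : ∀ {n x a} .{{_ : NonZero n}} c → x ^ a % n ≡ 1 % n → x ^ (c * a) % n ≡ 1 % n
%-root-* {n} {x} {a} c x^a≡1 = begin
  x ^ (c * a) % n   ≡⟨ cong (λ k → x ^ k % n) (ℕ.*-comm c a) ⟩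
  x ^ (a * c) % n   ≡⟨ cong (_% n) (ℕ.^-*-assoc x a c) ⟨
  (x ^ a) ^ c % n   ≡⟨ %-cong-^ (x ^ a) 1 c x^a≡1 ⟩
  1 ^ c % n         ≡⟨ cong (_% n) (ℕ.^-zeroˡ c) ⟩
  1 % n             ∎
  where open ≡-Reasoning

-- Bézout's identity written without negative coefficients, hence without negative exponents:
-- `x ^ g` may be multiplied by `x ^ (v * b)`, which is 1, to give `x ^ (u * a)`. The other sign is
-- covered by exchanging `a` and `b`.
%-root-bézout : ∀ {n x} .{{_ : NonZero n}} u v a b {g} →
                 x ^ a % n ≡ 1 % n → x ^ b % n ≡ 1 % n → g + v * b ≡ u * a → x ^ g % n ≡ 1 % n
%-root-bézout {n} {x} u v a b {g} x^a≡1 x^b≡1 eq = begin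
  x ^ g % n                   ≡⟨ cong (_% n) (ℕ.*-identityʳ (x ^ g)) ⟨
  (x ^ g * 1) % n             ≡⟨ %-cong-* (x ^ g) (x ^ g) (x ^ (v * b)) 1 refl (%-root-* {x = x} v x^b≡1) ⟨
  (x ^ g * x ^ (v * b)) % n   ≡⟨ cong (_% n) (ℕ.^-distribˡ-+-* x g (v * b)) ⟨
  x ^ (g + v * b) % n         ≡⟨ cong (λ k → x ^ k % n) eq ⟩
  x ^ (u * a) % n             ≡⟨ %-root-* {x = x} u x^a≡1 ⟩
  1 % n                       ∎
  where open ≡-Reasoning

%-root-gcd : ∀ {n x} .{{_ : NonZero n}} a b → x ^ a % n ≡ 1 % n → x ^ b % n ≡ 1 % n →
             x ^ gcd a b % n ≡ 1 % n
%-root-gcd {n} {x} a b x^a≡1 x^b≡1 with Bézout.identity (gcd-GCD a b)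
... | Bézout.+- u v eq = %-root-bézout {x = x} u v a b x^a≡1 x^b≡1 eq
... | Bézout.-+ u v eq = %-root-bézout {x = x} v u b a x^b≡1 x^a≡1 eq

incongruent : ∀ {p} .{{_ : NonZero p}} {xs} → Unique xs → All (_< p) xs →
              AllPairs (λ x y → ¬ + p ℤ.∣ y ℤ.- x) (map +_ xs)
incongruent []          []          = []
incongruent {p} {x ∷ _} (x∉ ∷ xs!) (x<p ∷ xs<p) =
  All.map⁺ (All.zipWith (λ { {y} (x≢y , y<p) p∣y-x → x≢y (begin
    x     ≡⟨ m<n⇒m%n≡m x<p ⟨
    x % p ≡⟨ mod⇒% y x (ℤ∣⇒mod y x p∣y-x) ⟨
    y % p ≡⟨ m<n⇒m%n≡m y<p ⟩
    y     ∎) }) (x∉ , xs<p))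
  ∷ incongruent xs! xs<p
  where open ≡-Reasoning

module _ {p} (p-prime : Prime p) where

  private
    instance
      p≢0 : NonZero p
      p≢0 = prime⇒nonZero p-prime

  lagrange-ℤ* : ∀ {d xs} (cs : Vec ℤ d) → Unique xs → (∀ {x} → x ∈ xs → x ∈ ℤ* p) →
                (∀ {x} → x ∈ xs → + p ℤ.∣ eval cs (+ x)) → length xs ≤ d
  lagrange-ℤ* {d} {xs} cs xs! xs⊆ℤ* p∣f = subst (_≤ d) (length-map +_ xs)
    (lagrange p-prime cs (map +_ xs)
      (incongruent xs! (All.tabulate (proj₁ ∘ ∈-ℤ*⁻ ∘ xs⊆ℤ*))) (All.map⁺ (All.tabulate p∣f)))

  -- x ^ (p ∸ 1) - 1 = (x ^ suc g - 1) * H x for a monic H of degree s * suc g, and every x in ℤ* p is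
  -- a root of the left side; as neither factor has more roots than its degree, both attain it.
  length-roots-∣ : ∀ g s → suc s * suc g ≡ p ∸ 1 → length (roots p (suc g)) ≡ suc g
  length-roots-∣ g s sg≡p-1 = ℕ.≤-antisym roots-bound
    (ℕ.+-cancelʳ-≤ (s * suc g) (suc g) (length (roots p (suc g))) (begin
      suc g + s * suc g                        ≡⟨ sg≡p-1 ⟩
      p ∸ 1                                    ≡⟨ φ-prime p-prime ⟨
      φ p                                      ≡⟨ length-filter-¬ root? (ℤ* p) ⟨
      length (roots p (suc g)) + length others ≤⟨ ℕ.+-monoʳ-≤ (length (roots p (suc g))) others-bound ⟩
      length (roots p (suc g)) + s * suc g     ∎))
    where
    open ℕ.≤-Reasoning

    root? : Decidable (λ x → x ^ suc g ≡ 1 [mod p ])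
    root? x = x ^ suc g ≡? 1 [mod p ]

    others : List ℕ
    others = filter (¬? ∘ root?) (ℤ* p)

    others⁻ : ∀ {x} → x ∈ others → x ∈ ℤ* p × ¬ (x ^ suc g ≡ 1 [mod p ])
    others⁻ = ∈-filter⁻ (¬? ∘ root?) {xs = ℤ* p}

    roots-bound : length (roots p (suc g)) ≤ suc g
    -- The vector encodes `X ^ suc g - 1`; its length is `suc (g + 0)`, whence the transport.
    roots-bound = subst (length (roots p (suc g)) ≤_) (cong suc (ℕ.+-identityʳ g))
      (lagrange-ℤ* (-1ℤ ∷ replicate g 0ℤ ++ []) (roots-unique p (suc g))
        (proj₁ ∘ ∈-filter⁻ root? {xs = ℤ* p}) p∣f)
      where
      p∣f : ∀ {x} → x ∈ roots p (suc g) → + p ℤ.∣ eval (-1ℤ ∷ replicate g 0ℤ ++ []) (+ x)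
      p∣f {x} x∈ = subst (+ p ℤ.∣_) (sym eval≡)
        (mod⇒ℤ∣ (x ^ suc g) 1 (proj₂ (proj₂ (∈-roots⁻ p (suc g) x∈))))
        where
        eval≡ : eval (-1ℤ ∷ replicate g 0ℤ ++ []) (+ x) ≡ + (x ^ suc g) ℤ.- 1ℤ
        eval≡ = trans (cong (λ t → -1ℤ ℤ.+ + x ℤ.* t)
                        (trans (eval-monomial-++ g [] (+ x)) (ℤ.*-identityʳ ((+ x) ℤ.^ g))))
                (trans (ℤ.+-comm -1ℤ ((+ x) ℤ.* (+ x) ℤ.^ g)) (cong (ℤ._- 1ℤ) (sym (pos-^ x (suc g)))))

    others-bound : length others ≤ s * suc g
    others-bound = lagrange-ℤ* (geometric g s) (Unique.filter⁺ (¬? ∘ root?) (ℤ*-unique p))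
      (proj₁ ∘ others⁻) p∣H
      where
      p∣H : ∀ {x} → x ∈ others → + p ℤ.∣ eval (geometric g s) (+ x)
      -- By Fermat `p` divides the product of `x ^ suc g - 1` and the geometric sum at `x`; it does
      -- not divide the first factor, so it divides the second.
      p∣H {x} x∈ with x∈ℤ* , x≢1 ← others⁻ x∈ =
        [ (λ p∣y-1 → contradiction (ℤ∣⇒mod (x ^ suc g) 1
            (subst (λ t → + p ℤ.∣ t ℤ.- 1ℤ) (sym (pos-^ x (suc g))) p∣y-1)) x≢1)
        , id ]′
        (euclidsLemmaℤ p-prime _ _ (subst (+ p ℤ.∣_) (sym (eval-geometric g s (+ x)))
          (subst (λ t → + p ℤ.∣ t ℤ.- 1ℤ) (pos-^ x (suc s * suc g))
            (mod⇒ℤ∣ (x ^ (suc s * suc g)) 1 fermat))))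
        where
        fermat : x ^ (suc s * suc g) ≡ 1 [mod p ]
        fermat = subst (λ k → x ^ k ≡ 1 [mod p ]) (trans (φ-prime p-prime) (sym sg≡p-1))
                       (euler (proj₂ (∈-ℤ*⁻ x∈ℤ*)))

  length-roots-prime : ∀ m → length (roots p m) ≡ gcd m (p ∸ 1)
  length-roots-prime m = trans (cong length roots≡) (count (gcd m (p ∸ 1)) (gcd[m,n]∣n m (p ∸ 1)))
    where
    p-1≢0 : NonZero (p ∸ 1)
    p-1≢0 = ≢-nonZero (ℕ.m>n⇒m∸n≢0 (nonTrivial⇒n>1 p {{prime⇒nonTrivial p-prime}}))

    -- Since `p ∸ 1` is positive, so are its divisors and their cofactors. This covers `m = 0`,
    -- which occurs for `e = 1` and gives the gcd `p ∸ 1`.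
    count : ∀ g → g ∣ p ∸ 1 → length (roots p g) ≡ g
    count zero    0∣p-1                  = contradiction (0∣⇒≡0 0∣p-1) (≢-nonZero⁻¹ _ {{p-1≢0}})
    count (suc g) (divides zero    p-1≡) = contradiction p-1≡ (≢-nonZero⁻¹ _ {{p-1≢0}})
    count (suc g) (divides (suc s) p-1≡) = length-roots-∣ g s (sym p-1≡)

    roots≡ : roots p m ≡ roots p (gcd m (p ∸ 1))
    roots≡ = filter-cong-∈ _ _ (ℤ* p) to from
      where
      to : ∀ {x} → x ∈ ℤ* p → x ^ m ≡ 1 [mod p ] → x ^ gcd m (p ∸ 1) ≡ 1 [mod p ]
      to {x} x∈ x^m≡1 = %⇒mod (x ^ gcd m (p ∸ 1)) 1
        (%-root-gcd {x = x} m (p ∸ 1) (mod⇒% (x ^ m) 1 x^m≡1)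
          (trans (cong (λ k → x ^ k % p) (sym (φ-prime p-prime)))
                 (mod⇒% (x ^ φ p) 1 (euler (proj₂ (∈-ℤ*⁻ x∈))))))

      from : ∀ {x} → x ∈ ℤ* p → x ^ gcd m (p ∸ 1) ≡ 1 [mod p ] → x ^ m ≡ 1 [mod p ]
      from {x} _ x^g≡1 with divides c m≡cg ← gcd[m,n]∣m m (p ∸ 1) =
        %⇒mod (x ^ m) 1 (trans (cong (λ k → x ^ k % p) m≡cg)
                               (%-root-* {x = x} c (mod⇒% (x ^ gcd m (p ∸ 1)) 1 x^g≡1)))

-- Periodic points of x ↦ x ^ e

module _ (n e : ℕ) .{{_ : NonZero n}} where

  Fixed : ℕ → ℕ → Set
  Fixed x d = x ^ (e ^ d) ≡ x [mod n ]

  fixed? : ∀ x → Decidable (Fixed x)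
  fixed? x d = x ^ (e ^ d) ≡? x [mod n ]

  module _ (x : ℕ) where

    fixed-zero : Fixed x 0
    fixed-zero = %⇒mod (x ^ 1) x (cong (_% n) (ℕ.^-identityʳ x))

    -- Raising to the power `e` a total of `a + b` times may begin with the `a` steps that lead back
    -- to `x`. Both closure properties of the periods follow.
    fixed-shift : ∀ a b → Fixed x a → x ^ (e ^ (a + b)) % n ≡ x ^ (e ^ b) % n
    fixed-shift a b x-fixed = begin
      x ^ (e ^ (a + b)) % n         ≡⟨ cong (λ j → x ^ j % n) (ℕ.^-distribˡ-+-* e a b) ⟩
      x ^ (e ^ a * e ^ b) % n       ≡⟨ cong (_% n) (ℕ.^-*-assoc x (e ^ a) (e ^ b)) ⟨
      (x ^ (e ^ a)) ^ (e ^ b) % n   ≡⟨ %-cong-^ (x ^ (e ^ a)) x (e ^ b) (mod⇒% (x ^ (e ^ a)) x x-fixed) ⟩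
      x ^ (e ^ b) % n               ∎
      where open ≡-Reasoning

    fixed-+ : ∀ a b → Fixed x a → Fixed x b → Fixed x (a + b)
    fixed-+ a b fa fb = %⇒mod (x ^ (e ^ (a + b))) x
      (trans (fixed-shift a b fa) (mod⇒% (x ^ (e ^ b)) x fb))

    fixed-+⁻ : ∀ a b → Fixed x a → Fixed x (a + b) → Fixed x b
    fixed-+⁻ a b fa fab = %⇒mod (x ^ (e ^ b)) x
      (trans (sym (fixed-shift a b fa)) (mod⇒% (x ^ (e ^ (a + b))) x fab))

  length-fixed : .{{_ : NonZero e}} → ∀ d →
    length (filter (λ x → fixed? x d) (ℤ* n)) ≡ length (roots n (e ^ d ∸ 1))
  length-fixed d = cong length (filter-cong-∈ _ _ (ℤ* n) to from)
    where
    power : ∀ x → x ^ (e ^ d) ≡ x * x ^ (e ^ d ∸ 1)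
    -- As `e` is nonzero, `e ^ d` is positive and the truncated subtraction is exact.
    power x = cong (x ^_) (sym (ℕ.suc-pred (e ^ d) {{ℕ.m^n≢0 e d}}))

    to : ∀ {x} → x ∈ ℤ* n → Fixed x d → x ^ (e ^ d ∸ 1) ≡ 1 [mod n ]
    to {x} x∈ x-fixed = mod-cancelˡ {x ^ (e ^ d ∸ 1)} {1} x (proj₂ (∈-ℤ*⁻ x∈))
      (subst₂ (_≡_[mod n ]) (power x) (sym (ℕ.*-identityʳ x)) x-fixed)

    from : ∀ {x} → x ∈ ℤ* n → x ^ (e ^ d ∸ 1) ≡ 1 [mod n ] → Fixed x d
    from {x} _ x^≡1 = %⇒mod (x ^ (e ^ d)) x (trans (cong (_% n) (power x))
      (trans (%-cong-* x x (x ^ (e ^ d ∸ 1)) 1 refl (mod⇒% (x ^ (e ^ d ∸ 1)) 1 x^≡1))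
             (cong (_% n) (ℕ.*-identityʳ x))))

  -- Membership in `T` is replaced by its Möbius sum and the summations are exchanged; the inner sum
  -- then counts the `x` having `d` as a period. The right-hand side unfolds to a
  -- `sumOver (predDivisors k)`.
  length-T : ∀ k .{{_ : NonZero k}} → .{{_ : NonZero e}} → + length (T n e k) ≡
    ∑[ d ∣ k ] (μ (k / d) ℤ.* + length (roots n (e ^ d ∸ 1)))
  length-T k = begin
    + length (T n e k)
      ≡⟨ length-filter-⟦⟧ (isT? n e k) (ℤ* n) ⟩
    sumOver (ℤ* n) (λ x → ⟦ isT? n e k x ⟧)
      ≡⟨ sumOver-cong (ℤ* n) (λ {x} _ →
           möbius-minimal (fixed? x) (fixed-zero x) (λ {a} {b} → fixed-+ x a b) (λ {a} {b} → fixed-+⁻ x a b)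
             k (isT? n e k x)) ⟨
    sumOver (ℤ* n) (λ x → sumOver (predDivisors k) (λ i → μ (k / suc i) ℤ.* ⟦ fixed? x (suc i) ⟧))
      ≡⟨ sumOver-swap (ℤ* n) (predDivisors k) _ ⟩
    sumOver (predDivisors k) (λ i → sumOver (ℤ* n) (λ x → μ (k / suc i) ℤ.* ⟦ fixed? x (suc i) ⟧))
      ≡⟨ sumOver-cong (predDivisors k) (λ {i} _ → summand i) ⟩
    sumOver (predDivisors k) (λ i → μ (k / suc i) ℤ.* + length (roots n (e ^ suc i ∸ 1))) ∎
    where
    open ≡-Reasoning

    summand : ∀ i → sumOver (ℤ* n) (λ x → μ (k / suc i) ℤ.* ⟦ fixed? x (suc i) ⟧) ≡
                    μ (k / suc i) ℤ.* + length (roots n (e ^ suc i ∸ 1))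
    summand i = trans
      (sym (sumOver-*ˡ (ℤ* n) (μ (k / suc i)) (λ x → ⟦ fixed? x (suc i) ⟧)))
      (cong (μ (k / suc i) ℤ.*_)
        (trans (sym (length-filter-⟦⟧ (λ x → fixed? x (suc i)) (ℤ* n))) (cong +_ (length-fixed (suc i)))))

theorem1 : (p q e k : ℕ) → Prime p → Prime q → p ≢ q →
    .{{_ : NonZero e}} → .{{_ : NonZero k}} →
    gcd e (φ (p * q)) ≡ 1 →
    + length (T (p * q) e k) ≡
    ∑[ d ∣ k ] (μ (k / d) ℤ.* + (gcd (e ^ d ∸ 1) (p ∸ 1) * gcd (e ^ d ∸ 1) (q ∸ 1)))
theorem1 p q e k p-prime q-prime p≢q _ = trans (length-T (p * q) e k)
  (sumOver-cong (predDivisors k) λ {i} _ → cong (λ c → μ (k / suc i) ℤ.* + c) (roots-count (e ^ suc i ∸ 1)))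
  where
  instance
    p≢0 : NonZero p
    p≢0 = prime⇒nonZero p-prime

    q≢0 : NonZero q
    q≢0 = prime⇒nonZero q-prime

    pq≢0 : NonZero (p * q)
    pq≢0 = ℕ.m*n≢0 p q

  roots-count : ∀ m → length (roots (p * q) m) ≡ gcd m (p ∸ 1) * gcd m (q ∸ 1)
  roots-count m = trans (length-roots-* (distinct-primes⇒coprime p-prime q-prime p≢q) m)
    (cong₂ _*_ (length-roots-prime p-prime m) (length-roots-prime q-prime m))
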